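{- Let $L\ge 5$ be an integer, and let $H=4C_L$ be the disjoint union of four cycles of length $L$. There exist an orientation $\vec H$ of $H$ (each cycle being oriented as a directed cycle) and a bijective labeling $h:V(\vec H)\to\{1,2,\dots,4L\}$ that has a repetitive, consecutive pattern, such that $\vec H$ with this labeling is an $s$-nodes ornament, where $s=L-1$ if $L$ is odd and $s=L-2$ if $L$ is even.
   Context: All graphs are finite and simple. An oriented graph is a digraph without loops in which $(u,v)$ being an edge implies $(v,u)$ is not an edge. An orientation of a cycle is always taken to be a directed cycle: every vertex has exactly one incoming and one outgoing edge (so each cycle has two possible orientations, and different copies may be oriented differently). **Weight.** For an oriented graph $\vec G$ with an injective integer labeling $f$ of its vertices, the weight of a vertex $x$ is $\mathrm{wt}_f(x)=\sum_{y:\,(y,x)\in E(\vec G)} f(y)-\sum_{y:\,(x,y)\in E(\vec G)} f(y)$. **DDMOG.** A difference distance magic (DDM) labeling of an oriented graph $\vec G$ on $n$ vertices is a bijection $f:V(\vec G)\to\{1,\dots,n\}$ such that $\mathrm{wt}_f(x)$ is the same constant for all vertices $x$ (this constant is necessarily $0$). An oriented graph having a DDM labeling is a difference distance magic oriented graph (DDMOG). Edgeless graphs are (trivial) DDMOGs. **Weighted sum.** Let $\vec G$ be an oriented graph with vertices $v_1,\dots,v_n$ labeled by $g(v_i)=i$ (for a DDMOG, $g$ is its DDM labeling), and let $\vec H$ be an oriented graph, vertex-disjoint from $\vec G$, with injective labeling $h:V(\vec H)\to\mathbb{Z}^+$ and $|\mathrm{wt}_h(u)|\in\{0,1,\dots,n\}$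 for all $u\in V(\vec H)$. The weighted sum $\vec G\oplus_{\mathrm{wt}_h}\vec H$ has vertex set $V(\vec G)\cup V(\vec H)$ and edge set consisting of $E(\vec G)\cup E(\vec H)$ together with, for each $1\le i\le n$, all edges $(u,v_i)$ with $u\in V(\vec H)$, $\mathrm{wt}_h(u)=i$, and all edges $(v_i,u)$ with $u\in V(\vec H)$, $\mathrm{wt}_h(u)=-i$. **$s$-nodes ornament.** Let $\vec H$ be an orientation of $4C_L$ and let $h:V(\vec H)\to\{1,\dots,4L\}$ be a bijection. (The weights $\mathrm{wt}_{N+h}$ of the shifted labelings $u\mapsto N+h(u)$ do not depend on $N$.) $\vec H$ with this labeling is an $s$-nodes ornament if (i) for every integer $N\ge\max_u|\mathrm{wt}_h(u)|$, $N\ge1$, and every DDMOG $\vec G$ on $N$ vertices with DDM labeling $g$, the weighted sum $\vec G\oplus_{\mathrm{wt}_{N+h}}\vec H$ is a DDMOG with a DDM labeling given by $g$ on $V(\vec G)$ and $N+h$ on $V(\vec H)$; and (ii) exactly $s$ vertices of $\vec G$ (called nodes) are joined to vertices of $\vec H$ in this weighted sum, each of them to at least two vertices of $\vec H$. The labels of the nodes are their values under $g$; equivalently they are the distinct nonzero values of $|\mathrm{wt}_h|$. **Repetitive, consecutive pattern.** Let the four cycles $H_1,\dots,H_4$ be copies of one cycle $C_L$ with vertices $v_1,\dots,v_L$, and let $v_i^{(j-1)}$ denote the copy of $v_i$ in $H_j$. The labeling $h$ has a repetitive, consecutive pattern if there is a permutation $l$ of $\{1,\dots,L\}$ with $h(v_i^{(j-1)})=l(i)+(j-1)L$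 for all $1\le j\le 4$, $1\le i\le L$ (when attached to a DDMOG with $N$ vertices, all labels are shifted by $N$). -}

module Defs where

open import Data.Bool.Base using (if_then_else_)
open import Data.Fin.Base using (Fin; toℕ)
open import Data.Fin.Properties using (+↔⊎; *↔×)
open import Data.Integer.Base as ℤ using (ℤ; +_; 0ℤ; ∣_∣)
import Data.Integer.Properties as ℤ
open import Data.Nat.Base using (ℕ; suc; _+_; _*_; _≤_; s≤s)
import Data.Nat.Properties as ℕ
open import Data.Product using (Σ-syntax; ∃-syntax; ∃!; _×_; _,_)
open import Data.Product.Function.NonDependent.Propositional using (_×-↔_)
open import Data.Sum.Base using (_⊎_; inj₁; inj₂; [_,_]; swap)
open import Data.Sum.Function.Propositional using (_⊎-↔_)
open import Function.Base using (_∘_)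
open import Function.Bundles using (_⇔_; _↔_; Inverse)
open import Function.Construct.Composition using (_↔-∘_)
open import Function.Construct.Symmetry using (↔-sym)
open import Function.Construct.Identity using (↔-id)
open import Function.Definitions using (Injective)
open import Level using (0ℓ)
open import Relation.Binary.Core using (Rel)
open import Relation.Binary.Definitions
  using (Asymmetric; Decidable; Irreflexive; Symmetric)
open import Relation.Binary.PropositionalEquality
  using (_≡_; _≢_; refl; sym; trans; cong)
open import Relation.Nullary using (does; ¬_)
open import Algebra.Properties.CommutativeMonoid.Sum ℤ.+-0-commutativeMonoid
  using (sum)

record Finite (V : Set) : Set where
  field
    size : ℕ
    enum : V ↔ Fin size

finite-Fin : ∀ n → Finite (Fin n)
finite-Fin n = record { size = n ; enum = ↔-id _ }

finite-⊎ : ∀ {V W} → Finite V → Finite W → Finite (V ⊎ W)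
finite-⊎ A B = record
  { size = Finite.size A + Finite.size B
  ; enum = ↔-sym +↔⊎ ↔-∘ (Finite.enum A ⊎-↔ Finite.enum B)
  }

finite-× : ∀ {V W} → Finite V → Finite W → Finite (V × W)
finite-× A B = record
  { size = Finite.size A * Finite.size B
  ; enum = ↔-sym *↔× ↔-∘ (Finite.enum A ×-↔ Finite.enum B)
  }

record SimpleGraph (V : Set) : Set₁ where
  infix 4 _~_
  field
    finite      : Finite V
    _~_         : Rel V 0ℓ
    symmetric   : Symmetric _~_
    irreflexive : Irreflexive _≡_ _~_

-- Asymmetry also excludes loops.
record OrientedGraph (V : Set) : Set₁ where
  infix 4 _⟶_ _⟶?_
  field
    finite     : Finite V
    _⟶_        : Rel V 0ℓ
    _⟶?_       : Decidable _⟶_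
    asymmetric : Asymmetric _⟶_

  open Finite finite public using () renaming (size to order)

  Adjacent : Rel V 0ℓ
  Adjacent u v = u ⟶ v ⊎ v ⟶ u

  ∑ : (V → ℤ) → ℤ
  ∑ φ = sum (φ ∘ Inverse.from (Finite.enum finite))

  wt : (V → ℕ) → V → ℤ
  wt f x = ∑ (λ y → if does (y ⟶? x) then + f y else 0ℤ)
     ℤ.- ∑ (λ y → if does (x ⟶? y) then + f y else 0ℤ)

-- f is a bijection from V onto {1, …, n}.
record BijectionOnto {V : Set} (n : ℕ) (f : V → ℕ) : Set where
  field
    positive   : ∀ x → 1 ≤ f x
    bounded    : ∀ x → f x ≤ n
    injective  : Injective _≡_ _≡_ f
    surjective : ∀ {i} → 1 ≤ i → i ≤ n → ∃[ x ] f x ≡ i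

record IsDDMLabeling {V : Set} (G : OrientedGraph V) (f : V → ℕ) : Set where
  open OrientedGraph G
  field
    bijection : BijectionOnto order f
    constant  : ∃[ k ] ∀ x → wt f x ≡ k

-- The vertex vᵢ of G is the one with g vᵢ = i; bijectivity of g is used only to
-- know that labels are nonzero, without which the arcs would not be asymmetric.
-- The construction makes sense for every h; a vertex of H with
-- |wt h u| > order G would simply not be joined to G.
module _ {V W : Set} (G : OrientedGraph V) (g : V → ℕ)
         (H : OrientedGraph W) (h : W → ℕ) where
  private
    module G = OrientedGraph G
    module H = OrientedGraph H

  WeightedSumArc : Rel (V ⊎ W) 0ℓ
  WeightedSumArc (inj₁ x) (inj₁ y) = x G.⟶ y
  WeightedSumArc (inj₂ u) (inj₂ w) = u H.⟶ w
  WeightedSumArc (inj₂ u) (inj₁ x) = H.wt h u ≡ + g x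
  WeightedSumArc (inj₁ x) (inj₂ u) = H.wt h u ≡ ℤ.- (+ g x)

  private
    arc? : Decidable WeightedSumArc
    arc? (inj₁ x) (inj₁ y) = x G.⟶? y
    arc? (inj₂ u) (inj₂ w) = u H.⟶? w
    arc? (inj₂ u) (inj₁ x) = H.wt h u ℤ.≟ + g x
    arc? (inj₁ x) (inj₂ u) = H.wt h u ℤ.≟ ℤ.- (+ g x)

    +≢- : ∀ {n} → 1 ≤ n → + n ≢ ℤ.- (+ n)
    +≢- (s≤s _) ()

    asym : (∀ x → 1 ≤ g x) → Asymmetric WeightedSumArc
    asym pos {inj₁ x} {inj₁ y} p q = G.asymmetric p q
    asym pos {inj₂ u} {inj₂ w} p q = H.asymmetric p q
    asym pos {inj₂ u} {inj₁ x} p q = +≢- (pos x) (trans (sym p) q)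
    asym pos {inj₁ x} {inj₂ u} p q = +≢- (pos x) (trans (sym q) p)

  weightedSum : BijectionOnto G.order g → OrientedGraph (V ⊎ W)
  weightedSum bij = record
    { finite     = finite-⊎ G.finite H.finite
    ; _⟶_        = WeightedSumArc
    ; _⟶?_       = arc?
    ; asymmetric = λ {a} {b} → asym (BijectionOnto.positive bij) {a} {b}
    }

-- Exactly s elements satisfy P: they are enumerated without repetition by Fin s.
Exactly : ∀ {A : Set} → ℕ → (A → Set) → Set
Exactly {A} s P =
  Σ[ e ∈ (Fin s → A) ] Injective _≡_ _≡_ e × (∀ a → P a ⇔ (∃[ i ] e i ≡ a))

-- The vertex x of the left summand is joined to the right summand.
IsNode : ∀ {V W : Set} → OrientedGraph (V ⊎ W) → V → Set
IsNode S x = ∃[ u ] OrientedGraph.Adjacent S (inj₁ x) (inj₂ u)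

-- N is the order of G, and the hypothesis N ≥ max |wt h u| is written pointwise.
IsOrnament : ∀ {W : Set} → ℕ → OrientedGraph W → (W → ℕ) → Set₁
IsOrnament s H h =
  ∀ {V : Set} (G : OrientedGraph V) (g : V → ℕ) (ddm : IsDDMLabeling G g) →
  let N  = OrientedGraph.order G
      h⁺ = λ u → N + h u
      S  = weightedSum G g H h⁺ (IsDDMLabeling.bijection ddm)
      open OrientedGraph S using (Adjacent)
  in
  1 ≤ N →
  (∀ u → ∣ OrientedGraph.wt H h u ∣ ≤ N) →
  IsDDMLabeling S [ g , h⁺ ]
    × Exactly s (IsNode S)
    × (∀ x → IsNode S x →
         ∃[ u ] ∃[ w ] u ≢ w × Adjacent (inj₁ x) (inj₂ u) × Adjacent (inj₁ x) (inj₂ w))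

-- j is the cyclic successor of i.
Next : ∀ {L} → Rel (Fin L) 0ℓ
Next {L} i j = suc (toℕ i) ≡ toℕ j ⊎ (suc (toℕ i) ≡ L × toℕ j ≡ 0)

cycle : ∀ L → 3 ≤ L → SimpleGraph (Fin L)
cycle L 3≤L = record
  { finite      = finite-Fin L
  ; _~_         = λ i j → Next i j ⊎ Next j i
  ; symmetric   = swap
  ; irreflexive = λ { {i} refl → [ noLoop 3≤L i , noLoop 3≤L i ] }
  }
  where
  noLoop : ∀ {L} → 3 ≤ L → (i : Fin L) → ¬ Next i i
  noLoop _ i (inj₁ p) = ℕ.1+n≢n p
  noLoop (s≤s (s≤s _)) i (inj₂ (p , q)) with trans (sym p) (cong suc q)
  ... | ()

copies : ∀ {V} k → SimpleGraph V → SimpleGraph (Fin k × V)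
copies k Γ = record
  { finite      = finite-× (finite-Fin k) finite
  ; _~_         = λ (a , u) (b , v) → a ≡ b × u ~ v
  ; symmetric   = λ (p , q) → sym p , symmetric q
  ; irreflexive = λ { refl (_ , q) → irreflexive refl q }
  }
  where open SimpleGraph Γ

IsOrientationOf : ∀ {V} → SimpleGraph V → OrientedGraph V → Set
IsOrientationOf Γ H =
  ∀ u v → SimpleGraph._~_ Γ u v ⇔ OrientedGraph.Adjacent H u v

-- For a disjoint union of cycles this says that each cycle is oriented as a
-- directed cycle, independently of the others.
IsDirectedCycleOrientationOf : ∀ {V} → SimpleGraph V → OrientedGraph V → Set
IsDirectedCycleOrientationOf Γ H =
  IsOrientationOf Γ H × (∀ v → ∃! _≡_ (_⟶ v) × ∃! _≡_ (v ⟶_))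
  where open OrientedGraph H

-- Indices start at 0: (j , i) is the copy of the (i+1)-st vertex of the cycle in
-- the (j+1)-st cycle, so the shift is j L.
RepetitiveConsecutive : ∀ {L} → (Fin 4 × Fin L → ℕ) → Set
RepetitiveConsecutive {L} h =
  Σ[ l ∈ (Fin L → ℕ) ] BijectionOnto L l × (∀ j i → h (j , i) ≡ l i + toℕ j * L)

{-# OPTIONS --safe #-}
module Submission where

-- If the label of vᵢ in copy j is l(i) + jL, its weight is ±(l(i-1) - l(i+1)), with the
-- sign given by the direction of that copy. Directing the copies as +, -, -, + makes the
-- four copies of vᵢ contribute 0 to the weight of the node they are joined to, and the
-- other weights vanish by the definition of the weighted sum; so every permutation l
-- gives an ornament, whose node labels are the numbers |l(i-1) - l(i+1)|.
--
-- It remains to choose l. Walk along the cycle in steps of two, through v₀, v₂, v₄, …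
-- and then v₁, v₃, …, and label the vertices met by the zigzag 1, L, 2, L-1, …, whose
-- consecutive differences are L-1, L-2, …, 1. For odd L the walk is a single closed
-- cycle, so all these differences are node labels. For even L it splits into two
-- cycles, which loses exactly the difference L/2 between the two halves, and the two
-- closing steps do not bring it back.

open import Defs
open import Data.Bool.Base using (Bool; true; false; if_then_else_)
open import Data.Fin.Base as Fin using (Fin; zero; suc; toℕ; fromℕ<)
import Data.Fin.Properties as Fin
open import Data.Integer.Base as ℤ using (ℤ; +_; -[1+_]; 0ℤ; ∣_∣; -_)
import Data.Integer.Properties as ℤ
import Data.Integer.Tactic.RingSolver as ℤ
open import Data.Nat.Base
open import Data.Nat.Divisibility using (_∣_; _∣?_; divides)
open import Data.Nat.Properties
open import Data.Nat.Tactic.RingSolver using (solve-∀)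
open import Data.Product using (Σ-syntax; ∃-syntax; ∃!; _×_; _,_; proj₁; proj₂; swap; map₂)
open import Data.Sum.Base using (_⊎_; inj₁; inj₂; [_,_]; map; map₁) renaming (swap to ⊎-swap)
open import Function.Base using (_∘_)
open import Function.Bundles using (Inverse; _⇔_; mk⇔; Equivalence)
open import Function.Definitions using (Injective)
open import Level using (0ℓ)
open import Relation.Nullary using (Dec; yes; no; does; ¬_; contradiction)
open import Relation.Nullary.Decidable using (dec-true; dec-false; does-⇔; _⊎-dec_; _×-dec_)
open import Relation.Binary.Core using (Rel)
open import Relation.Binary.Definitions using (Asymmetric; Decidable; Tri; tri<; tri≈; tri>)
open import Relation.Binary.PropositionalEquality hiding ([_])
open import Algebra.Properties.Semiring.Sum ℤ.+-*-semiring
  using (sum; sum-cong-≗; sum-replicate-zero; sum-remove; ∑-distrib-+; ∑-comm; *-distribˡ-sum)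

private
  variable
    V W : Set

-- Finite sets and finite sums.

-- If `j` were missed, punching it out would leave an injection into a set with one element fewer.
injective⇒surjective : ∀ {n} (f : Fin n → Fin n) → Injective _≡_ _≡_ f → ∀ j → ∃[ i ] f i ≡ j
injective⇒surjective {suc n} f inj j with Fin.any? (λ i → f i Fin.≟ j)
... | yes found = found
... | no  ∄i    = contradiction
  (Fin.injective⇒≤ {f = λ i → Fin.punchOut {i = j} {f i} (λ eq → ∄i (i , sym eq))}
    (λ eq → inj (Fin.punchOut-injective {i = j} _ _ eq)))
  1+n≰n

-- Surjectivity is the pigeonhole principle: read through the enumeration and lowered by one, `f` is
-- an injective self-map of `Fin size`.
bijectionOnto : (F : Finite V) {f : V → ℕ} → (∀ x → 1 ≤ f x) → (∀ x → f x ≤ Finite.size F) →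
  Injective _≡_ _≡_ f → BijectionOnto (Finite.size F) f
bijectionOnto F {f} pos bnd inj = record
  { positive = pos ; bounded = bnd ; injective = inj ; surjective = surj }
  where
  open Inverse (Finite.enum F)
  suc-pred-f : ∀ x → suc (pred (f x)) ≡ f x
  suc-pred-f x = suc-pred (f x) ⦃ >-nonZero (pos x) ⦄
  index-< : ∀ x → pred (f x) < Finite.size F
  index-< x = subst (_≤ Finite.size F) (sym (suc-pred-f x)) (bnd x)
  index : Fin (Finite.size F) → Fin (Finite.size F)
  index i = fromℕ< (index-< (from i))
  index-injective : Injective _≡_ _≡_ index
  index-injective {i} {j} eq = trans (sym (strictlyInverseˡ i)) (trans (cong to (inj (begin
    f (from i)               ≡⟨ suc-pred-f (from i) ⟨
    suc (pred (f (from i)))  ≡⟨ cong suc (Fin.fromℕ<-injective _ _ (index-< (from i)) (index-< (from j)) eq) ⟩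
    suc (pred (f (from j)))  ≡⟨ suc-pred-f (from j) ⟩
    f (from j)               ∎))) (strictlyInverseˡ j))
    where open ≡-Reasoning
  surj : ∀ {i} → 1 ≤ i → i ≤ Finite.size F → ∃[ x ] f x ≡ i
  surj {suc i} _ i<n with k , eq ← injective⇒surjective index index-injective (fromℕ< i<n) =
    from k , trans (sym (suc-pred-f (from k)))
      (cong suc (Fin.fromℕ<-injective _ _ (index-< (from k)) i<n eq))

sumOver : Finite V → (V → ℤ) → ℤ
sumOver F φ = sum (φ ∘ Inverse.from (Finite.enum F))

sum-zero : ∀ {n} (t : Fin n → ℤ) → (∀ i → t i ≡ 0ℤ) → sum t ≡ 0ℤ
sum-zero {n} t t≡0 = trans (sum-cong-≗ t≡0) (sum-replicate-zero n)

sum-point : ∀ {n} (t : Fin n → ℤ) i → (∀ j → j ≢ i → t j ≡ 0ℤ) → sum t ≡ t i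
sum-point {suc n} t i vanish = trans (sum-remove {i = i} t)
  (trans (cong (ℤ._+_ (t i)) (sum-zero _ (λ j → vanish _ (Fin.punchInᵢ≢i i j)))) (ℤ.+-identityʳ (t i)))

sum-splitAt : ∀ m {n} (φ : Fin m ⊎ Fin n → ℤ) →
  sum (φ ∘ Fin.splitAt m) ≡ sum (φ ∘ inj₁) ℤ.+ sum (φ ∘ inj₂)
sum-splitAt zero    φ = sym (ℤ.+-identityˡ _)
sum-splitAt (suc m) φ = trans (cong (ℤ._+_ (φ (inj₁ zero))) (sum-splitAt m (φ ∘ map₁ suc)))
  (sym (ℤ.+-assoc (φ (inj₁ zero)) _ _))

sum-remQuot : ∀ m n (φ : Fin m × Fin n → ℤ) →
  sum (φ ∘ Fin.remQuot {m} n) ≡ sum (λ i → sum (λ j → φ (i , j)))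
sum-remQuot zero    n φ = refl
sum-remQuot (suc m) n φ =
  trans (sum-splitAt n (φ ∘ swap ∘ [ (_, zero) , map₂ suc ∘ Fin.quotRem {m} n ]))
    (cong (ℤ._+_ (sum λ j → φ (zero , j))) (sum-remQuot m n λ (i , j) → φ (suc i , j)))

-- Keeps a sum of natural labels recognisable as a natural number no smaller than any term, which
-- later makes the label sum positive.
sum-nonneg : ∀ {n} (t : Fin n → ℕ) → ∃[ m ] sum (+_ ∘ t) ≡ + m × (∀ i → t i ≤ m)
sum-nonneg {zero}  t = 0 , refl , λ ()
sum-nonneg {suc n} t with m , eq , bnd ← sum-nonneg (t ∘ suc) =
  t zero + m , cong (ℤ._+_ (+ t zero)) eq ,
  λ { zero → m≤m+n (t zero) m ; (suc i) → ≤-trans (bnd i) (m≤n+m m (t zero)) }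

module _ (F : Finite V) where
  open Inverse (Finite.enum F)

  sumOver-cong : {φ ψ : V → ℤ} → (∀ x → φ x ≡ ψ x) → sumOver F φ ≡ sumOver F ψ
  sumOver-cong eq = sum-cong-≗ (eq ∘ from)

  sumOver-zero : {φ : V → ℤ} → (∀ x → φ x ≡ 0ℤ) → sumOver F φ ≡ 0ℤ
  sumOver-zero eq = sum-zero _ (eq ∘ from)

  sumOver-point : (φ : V → ℤ) (x : V) → (∀ y → y ≢ x → φ y ≡ 0ℤ) → sumOver F φ ≡ φ x
  sumOver-point φ x vanish = trans
    (sum-point (φ ∘ from) (to x) λ j j≢ → vanish (from j)
      (λ eq → j≢ (trans (sym (strictlyInverseˡ j)) (cong to eq))))
    (cong φ (strictlyInverseʳ x))

  *-distribˡ-sumOver : ∀ c (φ : V → ℤ) → c ℤ.* sumOver F φ ≡ sumOver F (λ x → c ℤ.* φ x)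
  *-distribˡ-sumOver c φ = *-distribˡ-sum c (φ ∘ from)

  sumOver-neg : (φ : V → ℤ) → sumOver F (λ x → - φ x) ≡ - sumOver F φ
  sumOver-neg φ = begin
    sumOver F (λ x → - φ x)          ≡⟨ sumOver-cong (λ x → ℤ.-1*i≡-i (φ x)) ⟨
    sumOver F (λ x → ℤ.-1ℤ ℤ.* φ x)  ≡⟨ *-distribˡ-sumOver ℤ.-1ℤ φ ⟨
    ℤ.-1ℤ ℤ.* sumOver F φ            ≡⟨ ℤ.-1*i≡-i _ ⟩
    - sumOver F φ                    ∎
    where open ≡-Reasoning

  sumOver-- : (φ ψ : V → ℤ) → sumOver F (λ x → φ x ℤ.- ψ x) ≡ sumOver F φ ℤ.- sumOver F ψ
  sumOver-- φ ψ = trans (∑-distrib-+ (φ ∘ from) (-_ ∘ ψ ∘ from))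
    (cong (ℤ._+_ (sumOver F φ)) (sumOver-neg ψ))

  sumOver-nonneg : (f : V → ℕ) → ∃[ m ] sumOver F (+_ ∘ f) ≡ + m × (∀ x → f x ≤ m)
  sumOver-nonneg f with m , eq , bnd ← sum-nonneg (f ∘ from) =
    m , eq , λ x → subst (λ y → f y ≤ m) (strictlyInverseʳ x) (bnd (to x))

sumOver-⊎ : (F : Finite V) (F′ : Finite W) (φ : V ⊎ W → ℤ) →
  sumOver (finite-⊎ F F′) φ ≡ sumOver F (φ ∘ inj₁) ℤ.+ sumOver F′ (φ ∘ inj₂)
sumOver-⊎ F F′ φ = sum-splitAt (Finite.size F) (φ ∘ map (from F) (from F′))
  where
  from : ∀ {V} (F : Finite V) → Fin (Finite.size F) → V
  from F = Inverse.from (Finite.enum F)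

-- Weights in an oriented graph.

-- The contribution of a label v to the weight of a vertex, where b and c tell whether
-- there is an arc towards that vertex, respectively from it.
contribution : Bool → Bool → ℤ → ℤ
contribution b c v = (if b then v else 0ℤ) ℤ.- (if c then v else 0ℤ)

-- Factoring out the label leaves a coefficient 1, 0 or -1, so that identities between contributions
-- become ring identities.
contribution-linear : ∀ b c v → contribution b c v ≡ v ℤ.* contribution b c (+ 1)
contribution-linear true  true  v = trans (ℤ.+-inverseʳ v) (sym (ℤ.*-zeroʳ v))
contribution-linear true  false v = trans (ℤ.+-identityʳ v) (sym (ℤ.*-identityʳ v))
contribution-linear false true  v =
  trans (ℤ.+-identityˡ (- v)) (sym (trans (ℤ.*-comm v ℤ.-1ℤ) (ℤ.-1*i≡-i v)))
contribution-linear false false v = sym (ℤ.*-zeroʳ v)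

contribution-swap : ∀ b c v → contribution c b v ≡ - contribution b c v
contribution-swap b c v = begin
  contribution c b v                ≡⟨ contribution-linear c b v ⟩
  v ℤ.* contribution c b (+ 1)      ≡⟨ cong (ℤ._*_ v) (unit b c) ⟩
  v ℤ.* (- contribution b c (+ 1))  ≡⟨ ℤ.neg-distribʳ-* v (contribution b c (+ 1)) ⟨
  - (v ℤ.* contribution b c (+ 1))  ≡⟨ cong -_ (contribution-linear b c v) ⟨
  - contribution b c v              ∎
  where
  open ≡-Reasoning
  unit : ∀ b c → contribution c b (+ 1) ≡ - contribution b c (+ 1)
  unit true  true  = refl
  unit true  false = refl
  unit false true  = refl
  unit false false = refl

*-contribution : ∀ b c u v → u ℤ.* contribution b c v ≡ v ℤ.* contribution b c u
*-contribution b c u v rewrite contribution-linear b c u | contribution-linear b c v =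
  solve u v (contribution b c (+ 1))
  where
  solve : ∀ u v s → u ℤ.* (v ℤ.* s) ≡ v ℤ.* (u ℤ.* s)
  solve = ℤ.solve-∀

i≡-i⇒i≡0 : ∀ i → i ≡ - i → i ≡ 0ℤ
i≡-i⇒i≡0 (+ zero) _ = refl

module _ (G : OrientedGraph V) where
  open OrientedGraph G

  private
    inLabel outLabel flow : (V → ℕ) → V → V → ℤ
    inLabel  f x y = if does (y ⟶? x) then + f y else 0ℤ
    outLabel f x y = if does (x ⟶? y) then + f y else 0ℤ
    flow     f x y = contribution (does (y ⟶? x)) (does (x ⟶? y)) (+ f y)

  wt-contribution : ∀ f x →
    wt f x ≡ ∑ (λ y → contribution (does (y ⟶? x)) (does (x ⟶? y)) (+ f y))
  wt-contribution f x = sym (sumOver-- finite (inLabel f x) (outLabel f x))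

  wt-in-out : ∀ f {p x q} → p ⟶ x → (∀ {y} → y ⟶ x → p ≡ y) →
    x ⟶ q → (∀ {y} → x ⟶ y → q ≡ y) → wt f x ≡ + f p ℤ.- + f q
  wt-in-out f {p} {x} {q} p⟶x p-unique x⟶q q-unique = cong₂ ℤ._-_
    (trans (sumOver-point finite (inLabel f x) p λ y y≢p →
        off (dec-false (y ⟶? x) λ a → y≢p (sym (p-unique a))))
      (on (dec-true (p ⟶? x) p⟶x)))
    (trans (sumOver-point finite (outLabel f x) q λ y y≢q →
        off (dec-false (x ⟶? y) λ a → y≢q (sym (q-unique a))))
      (on (dec-true (x ⟶? q) x⟶q)))
    where
    on : ∀ {b n} → b ≡ true → (if b then + n else 0ℤ) ≡ + n
    on refl = refl
    off : ∀ {b n} → b ≡ false → (if b then + n else 0ℤ) ≡ 0ℤ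
    off refl = refl

  -- Every arc y → x contributes f x f y − f y f x to this sum.
  ∑-label*wt≡0 : ∀ f → ∑ (λ x → + f x ℤ.* wt f x) ≡ 0ℤ
  ∑-label*wt≡0 f = trans ∑≡∑∑ (i≡-i⇒i≡0 _ (begin
    ∑ (λ x → ∑ (m x))              ≡⟨ ∑-comm (λ i j → m (from i) (from j)) ⟩
    ∑ (λ y → ∑ (λ x → m x y))      ≡⟨ sumOver-cong finite (λ y → trans
                                        (sumOver-cong finite (λ x → m-antisym x y))
                                        (sumOver-neg finite (m y))) ⟩
    ∑ (λ y → - ∑ (m y))            ≡⟨ sumOver-neg finite (λ y → ∑ (m y)) ⟩
    - ∑ (λ x → ∑ (m x))            ∎))
    where
    open ≡-Reasoning
    open Inverse (Finite.enum finite) using (from)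
    m : V → V → ℤ
    m x y = + f x ℤ.* flow f x y
    m-antisym : ∀ x y → m x y ≡ - m y x
    m-antisym x y = begin
      m x y                                   ≡⟨ *-contribution b c (+ f x) (+ f y) ⟩
      + f y ℤ.* contribution b c (+ f x)      ≡⟨ cong (+ f y ℤ.*_) (contribution-swap c b (+ f x)) ⟩
      + f y ℤ.* (- contribution c b (+ f x))  ≡⟨ ℤ.neg-distribʳ-* (+ f y) _ ⟨
      - m y x                                 ∎
      where
      b = does (y ⟶? x)
      c = does (x ⟶? y)
    ∑≡∑∑ : ∑ (λ x → + f x ℤ.* wt f x) ≡ ∑ (λ x → ∑ (m x))
    ∑≡∑∑ = sumOver-cong finite λ x →
      trans (cong (+ f x ℤ.*_) (wt-contribution f x)) (*-distribˡ-sumOver finite (+ f x) (flow f x))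

  -- The constant weight `k` satisfies k · ∑ g = ∑ g · wt = 0, and the label sum is positive because
  -- it is at least the label of `x`.
  DDM⇒wt≡0 : ∀ {g} → IsDDMLabeling G g → ∀ x → wt g x ≡ 0ℤ
  DDM⇒wt≡0 {g} ddm x with k , wt≡k ← IsDDMLabeling.constant ddm | m , ∑g≡m , g≤m ← sumOver-nonneg finite g
    with ℤ.i*j≡0⇒i≡0∨j≡0 k {+ m} (begin
      k ℤ.* + m                   ≡⟨ cong (k ℤ.*_) ∑g≡m ⟨
      k ℤ.* ∑ (+_ ∘ g)            ≡⟨ *-distribˡ-sumOver finite k (+_ ∘ g) ⟩
      ∑ (λ x → k ℤ.* + g x)       ≡⟨ sumOver-cong finite (λ x → trans (ℤ.*-comm k (+ g x)) (cong (+ g x ℤ.*_) (sym (wt≡k x)))) ⟩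
      ∑ (λ x → + g x ℤ.* wt g x)  ≡⟨ ∑-label*wt≡0 g ⟩
      0ℤ                          ∎)
    where open ≡-Reasoning
  ... | inj₁ k≡0 = trans (wt≡k x) k≡0
  ... | inj₂ m≡0 = contradiction (ℤ.+-injective (sym m≡0))
    (<⇒≢ (≤-trans (BijectionOnto.positive (IsDDMLabeling.bijection ddm) x) (g≤m x)))

-- Weighted sums.

-- The contribution of a label v carried by a vertex of weight w to the vertex of
-- label n in a weighted sum.
arcContribution : ℤ → ℕ → ℤ → ℤ
arcContribution w n = contribution (does (w ℤ.≟ + n)) (does (w ℤ.≟ - (+ n)))

arcContribution-≢ : ∀ w {n} → n ≢ ∣ w ∣ → ∀ v → arcContribution w n v ≡ 0ℤ
arcContribution-≢ w {n} n≢ v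
  rewrite dec-false (w ℤ.≟ + n) (λ eq → n≢ (sym (cong ∣_∣ eq)))
        | dec-false (w ℤ.≟ - (+ n)) (λ eq → n≢ (sym (trans (cong ∣_∣ eq) (ℤ.∣-i∣≡∣i∣ (+ n))))) = refl

-- The direction of the joining arc records the sign of `w` and the label its modulus, so together
-- they give back `w`.
arcContribution-self : ∀ w → w ≢ 0ℤ → arcContribution w ∣ w ∣ (+ ∣ w ∣) ≡ w
arcContribution-self (+ zero)  w≢0 = contradiction refl w≢0
arcContribution-self w@(+ suc n) _ rewrite dec-true (w ℤ.≟ w) refl = ℤ.+-identityʳ w
arcContribution-self w@(-[1+ n ]) _ rewrite dec-true (w ℤ.≟ w) refl = refl

-- Negating the weight exchanges the two tests, that is, reverses the joining arc.
arcContribution-neg : ∀ w n v → arcContribution (- w) n v ≡ - arcContribution w n v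
arcContribution-neg w n v = trans
  (cong₂ (λ b c → contribution b c v)
    (does-⇔ (mk⇔ (λ eq → trans (sym (ℤ.neg-involutive w)) (cong -_ eq))
                 (λ eq → trans (cong -_ eq) (ℤ.neg-involutive (+ n))))
      (- w ℤ.≟ + n) (w ℤ.≟ - (+ n)))
    (does-⇔ (mk⇔ ℤ.neg-injective (cong -_)) (- w ℤ.≟ - (+ n)) (w ℤ.≟ + n)))
  (contribution-swap (does (w ℤ.≟ + n)) (does (w ℤ.≟ - (+ n))) v)

module WeightedSum (G : OrientedGraph V) (g : V → ℕ) (ddm : IsDDMLabeling G g)
                   (H : OrientedGraph W) (h : W → ℕ) where
  private
    module G = OrientedGraph G
    module H = OrientedGraph H
    module g = BijectionOnto (IsDDMLabeling.bijection ddm)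

  S : OrientedGraph (V ⊎ W)
  S = weightedSum G g H h (IsDDMLabeling.bijection ddm)

  open OrientedGraph S using (wt; Adjacent; _⟶?_)

  private
    flow : V ⊎ W → V ⊎ W → ℤ
    flow a b = contribution (does (b ⟶? a)) (does (a ⟶? b)) (+ [ g , h ] b)

    wt-split : ∀ a → wt [ g , h ] a ≡ G.∑ (flow a ∘ inj₁) ℤ.+ H.∑ (flow a ∘ inj₂)
    wt-split a = trans (wt-contribution S [ g , h ] a) (sumOver-⊎ G.finite H.finite (flow a))

    -- Only the vertex labelled `∣ w ∣` can contribute, and the bound makes it exist when `w` is
    -- nonzero. For weight 0 no vertex matches, since labels are positive.
    ∑-own-label : ∀ w → ∣ w ∣ ≤ G.order → G.∑ (λ x → arcContribution w (g x) (+ g x)) ≡ w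
    ∑-own-label w ∣w∣≤N with w ℤ.≟ 0ℤ
    ... | yes refl = sumOver-zero G.finite λ x →
      arcContribution-≢ 0ℤ (>⇒≢ (g.positive x)) (+ g x)
    ... | no w≢0 with x , gx≡∣w∣ ← g.surjective (n≢0⇒n>0 (w≢0 ∘ ℤ.∣i∣≡0⇒i≡0)) ∣w∣≤N = trans
      (sumOver-point G.finite _ x λ y y≢x →
        arcContribution-≢ w (λ eq → y≢x (g.injective (trans eq (sym gx≡∣w∣)))) (+ g y))
      (trans (cong (λ n → arcContribution w n (+ n)) gx≡∣w∣) (arcContribution-self w w≢0))

  -- Seen from `u` the joining arc points the other way, so `G` contributes the negative of
  -- `∑-own-label`, which cancels the weight of `u` in `H`.
  wt-right : ∀ u → ∣ H.wt h u ∣ ≤ G.order → wt [ g , h ] (inj₂ u) ≡ 0ℤ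
  wt-right u ∣w∣≤N = begin
    wt [ g , h ] (inj₂ u)
      ≡⟨ wt-split (inj₂ u) ⟩
    G.∑ (flow (inj₂ u) ∘ inj₁) ℤ.+ H.∑ (flow (inj₂ u) ∘ inj₂)
      ≡⟨ cong₂ ℤ._+_ (sumOver-cong G.finite λ x →
           contribution-swap (does (w ℤ.≟ + g x)) (does (w ℤ.≟ - (+ g x))) (+ g x))
         (sym (wt-contribution H h u)) ⟩
    G.∑ (λ x → - arcContribution w (g x) (+ g x)) ℤ.+ w
      ≡⟨ cong (ℤ._+ w) (sumOver-neg G.finite (λ x → arcContribution w (g x) (+ g x))) ⟩
    - G.∑ (λ x → arcContribution w (g x) (+ g x)) ℤ.+ w
      ≡⟨ cong (λ z → - z ℤ.+ w) (∑-own-label w ∣w∣≤N) ⟩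
    - w ℤ.+ w ≡⟨ ℤ.+-inverseˡ w ⟩
    0ℤ        ∎
    where
    open ≡-Reasoning
    w = H.wt h u

  wt-left : ∀ x → H.∑ (λ u → arcContribution (H.wt h u) (g x) (+ h u)) ≡ 0ℤ →
    wt [ g , h ] (inj₁ x) ≡ 0ℤ
  wt-left x balanced = trans (wt-split (inj₁ x))
    (cong₂ ℤ._+_ (trans (sym (wt-contribution G g x)) (DDM⇒wt≡0 G ddm x)) balanced)

  adjacent⇒label : ∀ {x u} → Adjacent (inj₁ x) (inj₂ u) → ∣ H.wt h u ∣ ≡ g x
  adjacent⇒label {x} (inj₁ eq) = trans (cong ∣_∣ eq) (ℤ.∣-i∣≡∣i∣ (+ g x))
  adjacent⇒label     (inj₂ eq) = cong ∣_∣ eq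

  label⇒adjacent : ∀ {x u} → ∣ H.wt h u ∣ ≡ g x → Adjacent (inj₁ x) (inj₂ u)
  label⇒adjacent {x} {u} eq with H.wt h u
  ... | + n      = inj₂ (cong +_ eq)
  ... | -[1+ n ] = inj₁ (cong (-_ ∘ +_) eq)

-- Counting the node labels.

-- Carries a count of labels over to vertices along the bijection; `range` guarantees that each
-- counted label belongs to a vertex.
Exactly-label : ∀ {N s g} {P : ℕ → Set} {Q : V → Set} → BijectionOnto N g →
  (∀ {k} → P k → 1 ≤ k × k ≤ N) → (∀ x → Q x ⇔ P (g x)) → Exactly s P → Exactly s Q
Exactly-label {g = g} bij range Q⇔P (e , e-inj , e-iff) =
  proj₁ ∘ vertex ,
  (λ {i} {j} eq → e-inj (trans (sym (proj₂ (vertex i))) (trans (cong g eq) (proj₂ (vertex j))))) ,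
  λ x → mk⇔
    (λ q → let i , eq = to (e-iff (g x)) (to (Q⇔P x) q) in i , injective (trans (proj₂ (vertex i)) eq))
    (λ { (i , refl) → from (Q⇔P x) (from (e-iff (g x)) (i , sym (proj₂ (vertex i)))) })
  where
  open BijectionOnto bij
  open Equivalence
  vertex : ∀ i → ∃[ x ] g x ≡ e i
  vertex i = let 1≤k , k≤N = range (from (e-iff (e i)) (i , refl)) in surjective 1≤k k≤N

-- The last condition is void for odd L.
NodeLabel : ℕ → ℕ → Set
NodeLabel L k = 0 < k × k < L × k * 2 ≢ L

Exactly-nodeLabel : ∀ {L} → 2 ≤ L → Exactly (if does (2 ∣? L) then L ∸ 2 else L ∸ 1) (NodeLabel L)
Exactly-nodeLabel {L@(suc (suc n))} (s≤s (s≤s _)) = byParity (2 ∣? L)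
  where
  allLabels : ¬ 2 ∣ L → Exactly (suc n) (NodeLabel L)
  allLabels 2∤L = suc ∘ toℕ , Fin.toℕ-injective ∘ suc-injective , λ k → mk⇔
    (λ { (s≤s 0≤k , s≤s k<L , _) → fromℕ< k<L , cong suc (Fin.toℕ-fromℕ< k<L) })
    (λ { (i , refl) → z<s , s<s (Fin.toℕ<n i) , λ eq → 2∤L (divides (suc (toℕ i)) (sym eq)) })

  -- An index `i` stands for the label `i + 1`, so leaving out the index `m` removes exactly the
  -- label L/2.
  allBut : ∀ {m} → L ≡ suc m * 2 → Exactly n (NodeLabel L)
  allBut {m} L≡1+m*2 = suc ∘ toℕ ∘ Fin.punchIn m̂ ,
    (λ eq → Fin.punchIn-injective m̂ _ _ (Fin.toℕ-injective (suc-injective eq))) , λ k → mk⇔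
    (λ { (s≤s {n = k} 0≤k , s≤s k<L , k*2≢L) →
      let m̂≢k̂ : m̂ ≢ fromℕ< k<L
          m̂≢k̂ eq = k*2≢L (trans
            (cong (λ k → suc k * 2) (sym (Fin.fromℕ<-injective m k m<1+n k<L eq))) (sym L≡1+m*2))
      in Fin.punchOut m̂≢k̂ ,
         cong suc (trans (cong toℕ (Fin.punchIn-punchOut m̂≢k̂)) (Fin.toℕ-fromℕ< k<L)) })
    (λ { (i , refl) → z<s , s<s (Fin.toℕ<n (Fin.punchIn m̂ i)) ,
      λ eq → Fin.punchInᵢ≢i m̂ i (Fin.toℕ-injective (trans
        (suc-injective (*-cancelʳ-≡ _ (suc m) 2 (trans eq L≡1+m*2))) (sym (Fin.toℕ-fromℕ< m<1+n)))) })
    where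
    m<1+n : m < suc n
    m<1+n = s≤s (subst (m ≤_) (suc-injective (suc-injective (sym L≡1+m*2))) (m≤m*n m 2))
    m̂ : Fin (suc n)
    m̂ = fromℕ< m<1+n

  -- Taking the decision as an argument lets the `if` in the type reduce with it. The quotient 0
  -- cannot occur, since `L` is positive.
  byParity : (d : Dec (2 ∣ L)) → Exactly (if does d then n else suc n) (NodeLabel L)
  byParity (yes (divides (suc m) eq)) = allBut {m} eq
  byParity (no 2∤L) = allLabels 2∤L

-- Directed cycles.

-- Two steps close up only in a cycle of length one or two. The cases record which of the steps wrap
-- around.
Next-≢ : ∀ {L} → 3 ≤ L → {i j k : Fin L} → Next i j → Next j k → toℕ i ≢ toℕ k
Next-≢ 3≤L (inj₁ p) (inj₁ q) r =
  <⇒≢ (m≤n⇒m≤1+n ≤-refl) (trans r (trans (sym q) (cong suc (sym p))))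
Next-≢ 3≤L (inj₁ p) (inj₂ (q , z)) r =
  >⇒≢ 3≤L (trans (sym q) (cong suc (trans (sym p) (cong suc (trans r z)))))
Next-≢ 3≤L (inj₂ (q , z)) (inj₁ p) r =
  >⇒≢ 3≤L (trans (sym q) (cong suc (trans r (trans (sym p) (cong suc z)))))
Next-≢ 3≤L (inj₂ (_ , z)) (inj₂ (q , _)) _ =
  >⇒≢ (≤-trans (n≤1+n 2) 3≤L) (trans (sym q) (cong suc z))

Next? : ∀ {L} → Decidable (Next {L})
Next? {L} i j = suc (toℕ i) ≟ toℕ j ⊎-dec (suc (toℕ i) ≟ L ×-dec toℕ j ≟ 0)

next : ∀ {L} (i : Fin L) → ∃[ j ] Next i j
next {suc n} i with m≤n⇒m<n∨m≡n (Fin.toℕ<n i)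
... | inj₁ 1+i<L = fromℕ< 1+i<L , inj₁ (sym (Fin.toℕ-fromℕ< 1+i<L))
... | inj₂ 1+i≡L = zero , inj₂ (1+i≡L , refl)

prev : ∀ {L} (i : Fin L) → ∃[ j ] Next j i
prev {suc n} zero    = Fin.fromℕ n , inj₂ (cong suc (Fin.toℕ-fromℕ n) , refl)
prev         (suc i) = Fin.inject₁ i , inj₁ (cong suc (Fin.toℕ-inject₁ i))

Next-functional : ∀ {L} {i j k : Fin L} → Next i j → Next i k → j ≡ k
Next-functional (inj₁ p) (inj₁ q) = Fin.toℕ-injective (trans (sym p) q)
Next-functional {j = j} (inj₁ p) (inj₂ (q , _)) =
  contradiction (trans (sym p) q) (<⇒≢ (Fin.toℕ<n j))
Next-functional {k = k} (inj₂ (q , _)) (inj₁ p) =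
  contradiction (trans (sym p) q) (<⇒≢ (Fin.toℕ<n k))
Next-functional (inj₂ (_ , p)) (inj₂ (_ , q)) = Fin.toℕ-injective (trans p (sym q))

Next-injective : ∀ {L} {i j k : Fin L} → Next i k → Next j k → i ≡ j
Next-injective (inj₁ p) (inj₁ q) = Fin.toℕ-injective (suc-injective (trans p (sym q)))
Next-injective (inj₁ p) (inj₂ (_ , z)) = contradiction (trans p z) λ ()
Next-injective (inj₂ (_ , z)) (inj₁ p) = contradiction (trans p z) λ ()
Next-injective (inj₂ (p , _)) (inj₂ (q , _)) = Fin.toℕ-injective (suc-injective (trans p (sym q)))

Step : ∀ {L} → Bool → Rel (Fin L) 0ℓ
Step true  i j = Next i j
Step false i j = Next j i

Step? : ∀ {L} b → Decidable (Step {L} b)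
Step? true  i j = Next? i j
Step? false i j = Next? j i

Step-asym : ∀ {L} → 3 ≤ L → ∀ b → Asymmetric (Step {L} b)
Step-asym 3≤L true  p q = Next-≢ 3≤L p q refl
Step-asym 3≤L false p q = Next-≢ 3≤L p q refl

predecessor : ∀ {L} b (i : Fin L) → ∃! _≡_ λ j → Step b j i
predecessor true  i = proj₁ (prev i) , proj₂ (prev i) , Next-injective (proj₂ (prev i))
predecessor false i = proj₁ (next i) , proj₂ (next i) , Next-functional (proj₂ (next i))

successor : ∀ {L} b (i : Fin L) → ∃! _≡_ λ j → Step b i j
successor true  i = predecessor false i
successor false i = predecessor true i

-- With these directions the signs of the four copies of a label have vanishing zeroth
-- and first moments: 1 - 1 - 1 + 1 = 0 and 0 - 1 - 2 + 3 = 0.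
forward : Fin 4 → Bool
forward zero                   = true
forward (suc zero)             = false
forward (suc (suc zero))       = false
forward (suc (suc (suc zero))) = true

directed : Bool → ℤ → ℤ
directed true  d = d
directed false d = - d

∣directed∣ : ∀ b d → ∣ directed b d ∣ ≡ ∣ d ∣
∣directed∣ true  d = refl
∣directed∣ false d = ℤ.∣-i∣≡∣i∣ d

directedCycles : ∀ {L} → 3 ≤ L → OrientedGraph (Fin 4 × Fin L)
directedCycles {L} 3≤L = record
  { finite     = finite-× (finite-Fin 4) (finite-Fin L)
  ; _⟶_        = λ (a , i) (b , j) → a ≡ b × Step (forward a) i j
  ; _⟶?_       = λ (a , i) (b , j) → a Fin.≟ b ×-dec Step? (forward a) i j
  ; asymmetric = λ { {a , _} (refl , p) (_ , q) → Step-asym 3≤L (forward a) p q }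
  }

module _ {L : ℕ} (3≤L : 3 ≤ L) where
  private
    H = directedCycles 3≤L

  open OrientedGraph H

  directedCycles-orientation : ∀ 3≤L′ → IsDirectedCycleOrientationOf (copies 4 (cycle L 3≤L′)) H
  directedCycles-orientation _ = (λ u v → mk⇔ orient unorient) , λ (a , i) → into a i , out a i
    where
    orient : ∀ {a i b j} → a ≡ b × (Next i j ⊎ Next j i) → Adjacent (a , i) (b , j)
    orient {a} (refl , p) with forward a
    orient (refl , inj₁ p) | true  = inj₁ (refl , p)
    orient (refl , inj₂ p) | true  = inj₂ (refl , p)
    orient (refl , inj₁ p) | false = inj₂ (refl , p)
    orient (refl , inj₂ p) | false = inj₁ (refl , p)
    unstep : ∀ b {i j : Fin L} → Step b i j → Next i j ⊎ Next j i
    unstep true  = inj₁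
    unstep false = inj₂
    unorient : ∀ {a i b j} → Adjacent (a , i) (b , j) → a ≡ b × (Next i j ⊎ Next j i)
    unorient {a} (inj₁ (refl , p)) = refl , unstep (forward a) p
    unorient {a} (inj₂ (refl , p)) = refl , ⊎-swap (unstep (forward a) p)
    into : ∀ a i → ∃! _≡_ (_⟶ (a , i))
    into a i = let p , p⟶i , uniq = predecessor (forward a) i in
      (a , p) , (refl , p⟶i) , λ { (refl , q) → cong (a ,_) (uniq q) }
    out : ∀ a i → ∃! _≡_ ((a , i) ⟶_)
    out a i = let p , p⟶i , uniq = successor (forward a) i in
      (a , p) , (refl , p⟶i) , λ { (refl , q) → cong (a ,_) (uniq q) }

  -- The offset `c a` is common to both neighbours and cancels. Reversing a copy exchanges its in-
  -- and out-neighbours and so flips the sign.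
  wt-directedCycles : ∀ f (l : Fin L → ℕ) (c : Fin 4 → ℕ) → (∀ a i → f (a , i) ≡ l i + c a) →
    ∀ a {p i q} → Next p i → Next i q → wt f (a , i) ≡ directed (forward a) (+ l p ℤ.- + l q)
  wt-directedCycles f l c f≡ a {p} {i} {q} pi iq = go (forward a) refl
    where
    cancel : ∀ x y → (+ f (a , x)) ℤ.- (+ f (a , y)) ≡ + l x ℤ.- + l y
    cancel x y = trans (cong₂ (λ m n → + m ℤ.- + n) (f≡ a x) (f≡ a y)) (solve (+ l x) (+ l y) (+ c a))
      where
      solve : ∀ x y z → (x ℤ.+ z) ℤ.- (y ℤ.+ z) ≡ x ℤ.- y
      solve = ℤ.solve-∀
    -- The direction enters through an equation, so that two cases suffice in place of four copies.
    toward : ∀ {b k} → Step b k i → forward a ≡ b → (a , k) ⟶ (a , i)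
    toward s refl = refl , s
    from : ∀ {b k} → Step b i k → forward a ≡ b → (a , i) ⟶ (a , k)
    from s refl = refl , s
    along : ∀ {b} {j k : Fin L} → forward a ≡ b → Step (forward a) j k → Step b j k
    along refl s = s
    go : ∀ b → forward a ≡ b → wt f (a , i) ≡ directed b (+ l p ℤ.- + l q)
    go true eq = trans
      (wt-in-out H f (toward {true} pi eq)
        (λ { (refl , s) → cong (a ,_) (Next-injective pi (along eq s)) })
        (from {true} iq eq)
        (λ { (refl , s) → cong (a ,_) (Next-functional iq (along eq s)) }))
      (cancel p q)
    go false eq = trans
      (wt-in-out H f (toward {false} iq eq)
        (λ { (refl , s) → cong (a ,_) (Next-functional iq (along eq s)) })
        (from {false} pi eq)
        (λ { (refl , s) → cong (a ,_) (Next-injective pi (along eq s)) }))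
      (trans (cancel q p) (flip (+ l p) (+ l q)))
      where
      flip : ∀ x y → y ℤ.- x ≡ - (x ℤ.- y)
      flip = ℤ.solve-∀

  private
    -- The two vanishing moments of the signs +, -, -, + kill the constant and the linear part of an
    -- arithmetic progression. The final `0ℤ` is what `sum` over `Fin 4` ends with.
    moments : ∀ b c x y →
      contribution b c x ℤ.+ (- contribution b c (x ℤ.+ y) ℤ.+ (- contribution b c (x ℤ.+ (y ℤ.+ y))
        ℤ.+ (contribution b c (x ℤ.+ (y ℤ.+ (y ℤ.+ y))) ℤ.+ 0ℤ))) ≡ 0ℤ
    moments b c x y
      rewrite contribution-linear b c x | contribution-linear b c (x ℤ.+ y)
            | contribution-linear b c (x ℤ.+ (y ℤ.+ y)) | contribution-linear b c (x ℤ.+ (y ℤ.+ (y ℤ.+ y))) =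
      solve x y (contribution b c (+ 1))
      where
      solve : ∀ x y s → x ℤ.* s ℤ.+ (- ((x ℤ.+ y) ℤ.* s) ℤ.+ (- ((x ℤ.+ (y ℤ.+ y)) ℤ.* s)
        ℤ.+ ((x ℤ.+ (y ℤ.+ (y ℤ.+ y))) ℤ.* s ℤ.+ 0ℤ))) ≡ 0ℤ
      solve = ℤ.solve-∀

  -- Grouped by position on the cycle, the four copies have weights ±d and labels `L` apart, so
  -- `moments` makes each group vanish.
  directedCycles-balanced : ∀ f (m : Fin L → ℕ) → (∀ a i → f (a , i) ≡ m i + toℕ a * L) →
    ∀ n → ∑ (λ u → arcContribution (wt f u) n (+ f u)) ≡ 0ℤ
  directedCycles-balanced f m f≡ n = trans (sum-remQuot 4 L (λ u → arcContribution (wt f u) n (+ f u)))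
    (trans (∑-comm (λ a i → arcContribution (wt f (a , i)) n (+ f (a , i))))
      (sum-zero {L} (λ i → sum (λ a → arcContribution (wt f (a , i)) n (+ f (a , i)))) column))
    where
    column : ∀ i → sum (λ a → arcContribution (wt f (a , i)) n (+ f (a , i))) ≡ 0ℤ
    column i = trans (sum-cong-≗ {4} term) (moments (does (d ℤ.≟ + n)) (does (d ℤ.≟ - (+ n))) (+ m i) (+ L))
      where
      d = + m (proj₁ (prev i)) ℤ.- + m (proj₁ (next i))
      offset : Fin 4 → ℤ
      offset zero                   = + m i
      offset (suc zero)             = + m i ℤ.+ + L
      offset (suc (suc zero))       = + m i ℤ.+ (+ L ℤ.+ + L)
      offset (suc (suc (suc zero))) = + m i ℤ.+ (+ L ℤ.+ (+ L ℤ.+ + L))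
      offset≡ : ∀ a → + f (a , i) ≡ offset a
      offset≡ a = trans (cong +_ (f≡ a i)) (go a)
        where
        go : ∀ a → + (m i + toℕ a * L) ≡ offset a
        go zero                   = cong +_ (+-identityʳ (m i))
        go (suc zero)             = cong (λ z → + (m i + z)) (+-identityʳ L)
        go (suc (suc zero))       = cong (λ z → + (m i + (L + z))) (+-identityʳ L)
        go (suc (suc (suc zero))) = cong (λ z → + (m i + (L + (L + z)))) (+-identityʳ L)
      arc : Bool → ℤ → ℤ
      arc true  v = arcContribution d n v
      arc false v = - arcContribution d n v
      arc-directed : ∀ b v → arcContribution (directed b d) n v ≡ arc b v
      arc-directed true  v = refl
      arc-directed false v = arcContribution-neg d n v
      term : ∀ a → arcContribution (wt f (a , i)) n (+ f (a , i)) ≡ arc (forward a) (offset a)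
      term a = trans
        (cong₂ (λ w v → arcContribution w n v)
          (wt-directedCycles f m (λ a → toℕ a * L) f≡ a (proj₂ (prev i)) (proj₂ (next i))) (offset≡ a))
        (arc-directed (forward a) (offset a))

-- The zigzag sequence.

-- The terms zigzag n 0, zigzag n 1, … are 0, n-1, 1, n-2, …, up to index n-1: after its
-- first term, the sequence is the one for n-1 reflected.
zigzag : ℕ → ℕ → ℕ
zigzag (suc n) (suc t) = n ∸ zigzag n t
zigzag _       _       = 0

zigzag-< : ∀ {n t} → t < n → zigzag n t < n
zigzag-< {suc n} {zero}  _ = z<s
zigzag-< {suc n} {suc t} _ = s≤s (m∸n≤m n (zigzag n t))

zigzag-pos : ∀ {n t} → t < n → 0 < zigzag (suc n) (suc t)
zigzag-pos t<n = m<n⇒0<n∸m (zigzag-< t<n)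

zigzag-zero : ∀ n → zigzag n 0 ≡ 0
zigzag-zero zero    = refl
zigzag-zero (suc n) = refl

zigzag-injective : ∀ {n s t} → s < n → t < n → zigzag n s ≡ zigzag n t → s ≡ t
zigzag-injective {suc n} {zero}  {zero}  _ _ _ = refl
zigzag-injective {suc n} {zero}  {suc t} _ (s<s t<n) eq = contradiction eq (<⇒≢ (zigzag-pos t<n))
zigzag-injective {suc n} {suc s} {zero}  (s<s s<n) _ eq = contradiction (sym eq) (<⇒≢ (zigzag-pos s<n))
zigzag-injective {suc n} {suc s} {suc t} (s<s s<n) (s<s t<n) eq =
  cong suc (zigzag-injective s<n t<n
    (∸-cancelˡ-≡ (<⇒≤ (zigzag-< s<n)) (<⇒≤ (zigzag-< t<n)) eq))

-- Reflection is an isometry, so distances in the zigzag reduce to those in the shorter one.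
∣n∸a-n∸b∣≡∣a-b∣ : ∀ {n a b} → a ≤ n → b ≤ n → ∣ n ∸ a - n ∸ b ∣ ≡ ∣ a - b ∣
∣n∸a-n∸b∣≡∣a-b∣ {n} {zero} {b} _ b≤n =
  trans (m≤n⇒∣n-m∣≡n∸m (m∸n≤m n b)) (m∸[m∸n]≡n b≤n)
∣n∸a-n∸b∣≡∣a-b∣ {n} {a@(suc _)} {zero} a≤n _ =
  trans (m≤n⇒∣m-n∣≡n∸m (m∸n≤m n a)) (m∸[m∸n]≡n a≤n)
∣n∸a-n∸b∣≡∣a-b∣ (s≤s a≤n) (s≤s b≤n) = ∣n∸a-n∸b∣≡∣a-b∣ a≤n b≤n

-- The first step goes from 0 to `n`, and reflection turns the others into the steps of the shorter
-- zigzag, so the lengths are n, n-1, ..., 1.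
zigzag-step : ∀ {n t} → t < n →
  t + ∣ zigzag (suc n) t - zigzag (suc n) (suc t) ∣ ≡ n
zigzag-step {suc n} {zero}  _ = refl
zigzag-step {suc n} {suc t} (s<s t<n) = cong suc (trans
  (cong (_+_ t) (∣n∸a-n∸b∣≡∣a-b∣ (<⇒≤ (zigzag-< (m≤n⇒m≤1+n t<n))) (<⇒≤ (zigzag-< (s<s t<n)))))
  (zigzag-step t<n))

-- Up to reflection, the terms from index `s` on form the zigzag of length n - s, whose values are n
-- - s consecutive integers.
zigzag-tail : ∀ {n s t} → s ≤ t → t < n → s + ∣ zigzag n s - zigzag n t ∣ < n
zigzag-tail {suc n} {zero}  _ t<n = zigzag-< t<n
zigzag-tail {suc n} {suc s} {suc t} (s≤s s≤t) (s<s t<n) = s<s (subst (λ d → s + d < n)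
  (sym (∣n∸a-n∸b∣≡∣a-b∣ (<⇒≤ (zigzag-< (≤-<-trans s≤t t<n))) (<⇒≤ (zigzag-< t<n))))
  (zigzag-tail s≤t t<n))

-- Labelling the cycle in steps of two.

data Halving : ℕ → Set where
  even : ∀ t → Halving (t * 2)
  odd  : ∀ t → Halving (suc (t * 2))

halve : ∀ n → Halving n
halve zero = even 0
halve (suc n) with halve n
... | even t = odd t
... | odd t  = even (suc t)

-- The numbers at distance `n` from `n` are 0 and 2n, and the bound excludes the latter.
∣n-m∣≡n⇒m≡0 : ∀ {m n} → m < n + n → ∣ n - m ∣ ≡ n → m ≡ 0
∣n-m∣≡n⇒m≡0 {m} {n} m<n+n eq with ≤-total m n
... | inj₁ m≤n = ∸-cancelˡ-≡ m≤n z≤n (trans (sym (m≤n⇒∣n-m∣≡n∸m m≤n)) eq)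
... | inj₂ n≤m = contradiction
  (trans (sym (m+[n∸m]≡n n≤m)) (cong (_+_ n) (trans (sym (m≤n⇒∣m-n∣≡n∸m n≤m)) eq)))
  (<⇒≢ m<n+n)

-- Ranks 0, 2, 4, … by 0, 1, 2, … and 1, 3, 5, … by c, c+1, c+2, …, so that steps of two
-- become steps of one.
unshuffle : ℕ → ℕ → ℕ
unshuffle c zero          = 0
unshuffle c (suc zero)    = c
unshuffle c (suc (suc p)) = suc (unshuffle c p)

unshuffle-even : ∀ c t → unshuffle c (t * 2) ≡ t
unshuffle-even c zero    = refl
unshuffle-even c (suc t) = cong suc (unshuffle-even c t)

unshuffle-odd : ∀ c t → unshuffle c (suc (t * 2)) ≡ c + t
unshuffle-odd c zero    = sym (+-identityʳ c)
unshuffle-odd c (suc t) = trans (cong suc (unshuffle-odd c t)) (sym (+-suc c t))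

-- `c` and `f` are the upper and lower halves of `L`; they count the even and the odd positions.
module Labelling {c f : ℕ} (f≤c : f ≤ c) (c≤1+f : c ≤ suc f) (5≤c+f : 5 ≤ c + f) where

  private
    L = c + f

    n+n≡n*2 : ∀ n → n + n ≡ n * 2
    n+n≡n*2 = solve-∀

    even-< : ∀ {t} → t * 2 < L → t < c
    even-< {t} p = *-cancelʳ-< 2 t c
      (<-≤-trans p (≤-trans (+-monoʳ-≤ c f≤c) (≤-reflexive (n+n≡n*2 c))))

    odd-< : ∀ {t} → suc (t * 2) < L → t < f
    odd-< {t} p = *-cancelʳ-< 2 t f
      (s<s⁻¹ (<-≤-trans p (≤-trans (+-monoˡ-≤ f c≤1+f) (≤-reflexive (cong suc (n+n≡n*2 f))))))

    <-even : ∀ {t} → t < c → t * 2 < L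
    <-even {t} p = s<s⁻¹ (begin-strict
      suc (t * 2)   <⟨ n<1+n _ ⟩
      suc t * 2     ≡⟨ n+n≡n*2 (suc t) ⟨
      suc t + suc t ≤⟨ +-mono-≤ p (≤-trans p c≤1+f) ⟩
      c + suc f     ≡⟨ +-suc c f ⟩
      suc L         ∎)
      where open ≤-Reasoning

    <-odd : ∀ {t} → t < f → suc (t * 2) < L
    <-odd {t} p = begin
      suc t * 2     ≡⟨ n+n≡n*2 (suc t) ⟨
      suc t + suc t ≤⟨ +-mono-≤ (≤-trans p f≤c) p ⟩
      L             ∎
      where open ≤-Reasoning

    0<L : 0 < L
    0<L = ≤-trans z<s 5≤c+f

    0<c : 0 < c
    0<c = even-< 0<L

    3≤L : 3 ≤ L
    3≤L = ≤-trans (m≤m+n 3 2) 5≤c+f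

    1<L : 1 < L
    1<L = ≤-trans (n≤1+n 2) 3≤L

  unshuffle-< : ∀ {p} → p < L → unshuffle c p < L
  unshuffle-< {p} p<L with halve p
  ... | even t rewrite unshuffle-even c t = <-≤-trans (even-< p<L) (m≤m+n c f)
  ... | odd t  rewrite unshuffle-odd c t  = +-monoʳ-< c (odd-< p<L)

  -- Even positions get ranks below `c` and odd ones ranks from `c` on, so a clash can only occur
  -- within one parity.
  unshuffle-injective : ∀ {p q} → p < L → q < L → unshuffle c p ≡ unshuffle c q → p ≡ q
  unshuffle-injective {p} {q} p<L q<L eq with halve p | halve q
  ... | even s | even t rewrite unshuffle-even c s | unshuffle-even c t = cong (_* 2) eq
  ... | odd s  | odd t  rewrite unshuffle-odd c s | unshuffle-odd c t =
    cong (λ t → suc (t * 2)) (+-cancelˡ-≡ c s t eq)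
  ... | even s | odd t  rewrite unshuffle-even c s | unshuffle-odd c t =
    contradiction eq (<⇒≢ (<-≤-trans (even-< p<L) (m≤m+n c t)))
  ... | odd s  | even t rewrite unshuffle-odd c s | unshuffle-even c t =
    contradiction (sym eq) (<⇒≢ (<-≤-trans (even-< q<L) (m≤m+n c s)))

  height : ℕ → ℕ
  height p = zigzag L (unshuffle c p)

  height-< : ∀ {p} → p < L → height p < L
  height-< p<L = zigzag-< (unshuffle-< p<L)

  height-injective : ∀ {p q} → p < L → q < L → height p ≡ height q → p ≡ q
  height-injective p<L q<L eq =
    unshuffle-injective p<L q<L (zigzag-injective (unshuffle-< p<L) (unshuffle-< q<L) eq)

  gap : ℕ → ℕ → ℕ
  gap p q = ∣ height p - height q ∣

  gap-pos : ∀ {p q} → p < L → q < L → p ≢ q → 0 < gap p q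
  gap-pos p<L q<L p≢q = n≢0⇒n>0 λ eq → p≢q (height-injective p<L q<L (∣m-n∣≡0⇒m≡n eq))

  gap-< : ∀ {p q} → p < L → q < L → gap p q < L
  gap-< {p} {q} p<L q<L = ≤-<-trans (∣m-n∣≤m⊔n (height p) (height q)) (⊔-lub (height-< p<L) (height-< q<L))

  zigzag-step′ : ∀ {t} → suc t < L → suc t + ∣ zigzag L t - zigzag L (suc t) ∣ ≡ L
  zigzag-step′ {t} t<L with L | t<L
  ... | suc n | s<s t<n = cong suc (zigzag-step t<n)

  -- Moving from `p` to `p + 2` raises the rank by one definitionally, so it is a single step of the
  -- zigzag.
  gap-step : ∀ {p} → suc (suc p) < L → suc (unshuffle c p) + gap p (suc (suc p)) ≡ L
  gap-step p+2<L = zigzag-step′ (unshuffle-< p+2<L)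

  private
    -- If `c` exceeded `f`, then `L` would be odd and could not be twice `d`.
    half : ∀ {d} → d * 2 ≡ L → c ≡ f × d ≡ f
    half {d} eq with m≤n⇒m<n∨m≡n c≤1+f
    ... | inj₁ (s≤s c≤f) = c≡f , *-cancelʳ-≡ d f 2 (trans eq (trans (cong (_+ f) c≡f) (n+n≡n*2 f)))
      where
      c≡f : c ≡ f
      c≡f = ≤-antisym c≤f f≤c
    ... | inj₂ refl = contradiction
      (trans (*-comm 2 d) (trans eq (cong suc (trans (n+n≡n*2 f) (*-comm f 2))))) (even≢odd d f)

  -- By `gap-step`, only the step from rank c - 1 to rank c has length L/2. For even `L`, rank c - 1
  -- belongs to position L - 2, where `p + 2` is already out of range.
  gap-step-≢ : ∀ {p} → suc (suc p) < L → gap p (suc (suc p)) * 2 ≢ L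
  gap-step-≢ {p} p+2<L eq = <⇒≢ p+2<L (trans (cong (_+_ 2) p≡t*2) 1+t*2≡L)
    where
    gap≡f : gap p (suc (suc p)) ≡ f
    gap≡f = proj₂ (half eq)
    t = unshuffle c p
    1+t≡c : suc t ≡ c
    1+t≡c = +-cancelʳ-≡ f (suc t) c (trans (cong (_+_ (suc t)) (sym gap≡f)) (gap-step p+2<L))
    1+t*2≡L : suc t * 2 ≡ L
    1+t*2≡L = trans (cong (_* 2) (trans 1+t≡c (trans (proj₁ (half {gap p (suc (suc p))} eq)) (sym gap≡f)))) eq
    p≡t*2 : p ≡ t * 2
    p≡t*2 = unshuffle-injective (<-trans (n<1+n _) (<-trans (n<1+n _) p+2<L))
      (<-even (≤-reflexive 1+t≡c)) (sym (unshuffle-even c t))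

  -- If this gap were L/2, the next term of the zigzag would be at distance L/2 from
  -- L/2 as well, hence equal to the first term 0.
  gap-last-≢ : ∀ {p} → suc (suc p) ≡ L → gap p 0 * 2 ≢ L
  gap-last-≢ {p} p+2≡L eq with c≡f , gap≡f ← half {gap p 0} eq =
    contradiction (zigzag-injective 1+t<L 0<L (trans z′≡0 (sym (zigzag-zero L)))) λ ()
    where
    t = unshuffle c p
    1+[c-1]≡c : suc (pred c) ≡ c
    1+[c-1]≡c = suc-pred c ⦃ >-nonZero 0<c ⦄
    p≡[c-1]*2 : p ≡ pred c * 2
    p≡[c-1]*2 = suc-injective (suc-injective (trans p+2≡L (trans (cong (_+_ c) (sym c≡f))
      (trans (n+n≡n*2 c) (cong (_* 2) (sym 1+[c-1]≡c))))))
    1+t≡c : suc t ≡ c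
    1+t≡c = trans (cong suc (trans (cong (unshuffle c) p≡[c-1]*2) (unshuffle-even c (pred c)))) 1+[c-1]≡c
    1+t<L : suc t < L
    1+t<L = subst₂ _<_ (sym 1+t≡c) (cong (_+_ c) c≡f) (m<m+n c 0<c)
    z≡f : height p ≡ f
    z≡f = trans (sym (trans (cong (∣_-_∣ (height p)) (zigzag-zero L)) (∣-∣-identityʳ _))) gap≡f
    z′≡0 : zigzag L (suc t) ≡ 0
    z′≡0 = ∣n-m∣≡n⇒m≡0 (subst (zigzag L (suc t) <_) (cong (_+ f) c≡f) (zigzag-< 1+t<L))
      (trans (cong (λ z → ∣ z - zigzag L (suc t) ∣) (sym z≡f))
        (+-cancelˡ-≡ c _ f (trans (cong (_+ ∣ height p - zigzag L (suc t) ∣) (sym 1+t≡c)) (zigzag-step′ 1+t<L))))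

  -- From position c on, the zigzag stays within an interval of f consecutive integers.
  gap-first-≢ : ∀ {p} → suc p ≡ L → gap p 1 * 2 ≢ L
  gap-first-≢ {p} p+1≡L eq with c≡f , gap≡f ← half {gap p 1} eq =
    contradiction gap≡f (<⇒≢ (+-cancelˡ-< c _ f (subst (λ d → c + d < L)
      (∣-∣-comm (zigzag L c) (height p)) (zigzag-tail c≤t (unshuffle-< p<L)))))
    where
    p<L : p < L
    p<L = ≤-reflexive p+1≡L
    p≡1+[c-1]*2 : p ≡ suc (pred c * 2)
    p≡1+[c-1]*2 = suc-injective (trans p+1≡L (trans (cong (_+_ c) (sym c≡f))
      (trans (n+n≡n*2 c) (cong (_* 2) (sym (suc-pred c ⦃ >-nonZero 0<c ⦄))))))
    c≤t : c ≤ unshuffle c p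
    c≤t = subst (c ≤_) (sym (trans (cong (unshuffle c) p≡1+[c-1]*2) (unshuffle-odd c (pred c))))
      (m≤m+n c (pred c))

  -- The value L/2 is excluded by where the cycle wraps: nowhere, on the second step (from L - 2 to
  -- 0), or on the first (from L - 1 to 1).
  gap-sound : ∀ {i j k : Fin L} → Next i j → Next j k → NodeLabel L (gap (toℕ i) (toℕ k))
  gap-sound {i} {j} {k} ij jk =
    gap-pos i<L k<L (Next-≢ 3≤L ij jk) , gap-< i<L k<L , ≢half ij jk
    where
    i<L = Fin.toℕ<n i
    k<L = Fin.toℕ<n k
    ≢half : Next i j → Next j k → gap (toℕ i) (toℕ k) * 2 ≢ L
    ≢half (inj₁ p) (inj₁ q) with toℕ k | trans (sym q) (cong suc (sym p)) | k<L
    ... | _ | refl | k<L = gap-step-≢ k<L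
    ≢half (inj₁ p) (inj₂ (q , z)) rewrite z = gap-last-≢ (trans (cong suc p) q)
    ≢half (inj₂ (q , z)) (inj₁ p) rewrite sym p | z = gap-first-≢ q
    ≢half (inj₂ (_ , z)) (inj₂ (q , _)) = contradiction (trans (sym (cong suc z)) q) (<⇒≢ 1<L)

  -- The zigzag makes its step of length `d` from rank L - 1 - d. Unless this step leads from rank c
  -- - 1 to c, it joins two positions `p` and `p + 2`.
  gap-complete : ∀ {d} → NodeLabel L d →
    Σ[ i ∈ Fin L ] Σ[ j ∈ Fin L ] Σ[ k ∈ Fin L ] Next i j × Next j k × gap (toℕ i) (toℕ k) ≡ d
  gap-complete {d} (0<d , d<L , d*2≢L) = cases (<-cmp (suc t) c)
    where
    t = L ∸ suc d
    1+t+d≡L : suc t + d ≡ L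
    1+t+d≡L = trans (sym (+-suc t d)) (m∸n+n≡m d<L)
    1+t<L : suc t < L
    1+t<L = subst (suc t <_) 1+t+d≡L (m<m+n (suc t) 0<d)

    step : ∀ {p} → suc (suc p) < L → unshuffle c p ≡ t →
      Σ[ i ∈ Fin L ] Σ[ j ∈ Fin L ] Σ[ k ∈ Fin L ] Next i j × Next j k × gap (toℕ i) (toℕ k) ≡ d
    step {p} p+2<L u≡t = fromℕ< p<L , fromℕ< p+1<L , fromℕ< p+2<L ,
      inj₁ (trans (cong suc (Fin.toℕ-fromℕ< p<L)) (sym (Fin.toℕ-fromℕ< p+1<L))) ,
      inj₁ (trans (cong suc (Fin.toℕ-fromℕ< p+1<L)) (sym (Fin.toℕ-fromℕ< p+2<L))) ,
      trans (cong₂ gap (Fin.toℕ-fromℕ< p<L) (Fin.toℕ-fromℕ< p+2<L))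
        (+-cancelˡ-≡ (suc t) _ d (trans (cong (λ u → suc u + gap p (suc (suc p))) (sym u≡t))
          (trans (gap-step p+2<L) (sym 1+t+d≡L))))
      where
      p+1<L = <-trans (n<1+n _) p+2<L
      p<L = <-trans (n<1+n _) p+1<L

    cases : Tri (suc t < c) (suc t ≡ c) (c < suc t) →
      Σ[ i ∈ Fin L ] Σ[ j ∈ Fin L ] Σ[ k ∈ Fin L ] Next i j × Next j k × gap (toℕ i) (toℕ k) ≡ d
    cases (tri< 1+t<c _ _) = step (<-even 1+t<c) (unshuffle-even c t)
    cases (tri> _ _ (s≤s c≤t)) = step (<-odd 1+t-c<f)
      (trans (unshuffle-odd c (t ∸ c)) (m+[n∸m]≡n c≤t))
      where
      1+t-c<f : suc (t ∸ c) < f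
      1+t-c<f = +-cancelˡ-< c _ f (subst (_< L)
        (trans (cong suc (sym (m+[n∸m]≡n c≤t))) (sym (+-suc c (t ∸ c)))) 1+t<L)
    -- This step passes from the even to the odd positions. For even `L` its length is L/2, which is
    -- not a node label.
    cases (tri≈ _ 1+t≡c _) with m≤n⇒m<n∨m≡n c≤1+f
    ... | inj₁ (s≤s c≤f) = contradiction
      (trans (cong (_* 2) d≡f) (trans (sym (n+n≡n*2 f)) (cong (_+ f) (≤-antisym f≤c c≤f)))) d*2≢L
      where
      d≡f : d ≡ f
      d≡f = +-cancelˡ-≡ c d f (trans (cong (_+ d) (sym 1+t≡c)) 1+t+d≡L)
    -- For odd `L` the last position is 2t, of rank c - 1, and the cycle continues from it through 0
    -- to 1, which has rank c.
    ... | inj₂ c≡1+f = fromℕ< p<L , fromℕ< 0<L , fromℕ< 1<L ,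
      inj₂ (trans (cong suc (Fin.toℕ-fromℕ< p<L)) 1+p≡L , Fin.toℕ-fromℕ< 0<L) ,
      inj₁ (trans (cong suc (Fin.toℕ-fromℕ< 0<L)) (sym (Fin.toℕ-fromℕ< 1<L))) ,
      trans (cong₂ gap (Fin.toℕ-fromℕ< p<L) (Fin.toℕ-fromℕ< 1<L))
        (+-cancelˡ-≡ (suc t) _ d (trans
          (cong₂ (λ u v → suc t + ∣ zigzag L u - zigzag L v ∣) (unshuffle-even c t) (sym 1+t≡c))
          (trans (zigzag-step′ 1+t<L) (sym 1+t+d≡L))))
      where
      1+p≡L : suc (t * 2) ≡ L
      1+p≡L = trans (cong suc (sym (n+n≡n*2 t))) (cong₂ _+_ 1+t≡c (suc-injective (trans 1+t≡c c≡1+f)))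
      p<L : t * 2 < L
      p<L = ≤-reflexive 1+p≡L

-- Assembling the ornament.

∣+m-+n∣≡∣m-n∣ : ∀ m n → ∣ + m ℤ.- + n ∣ ≡ ∣ m - n ∣
∣+m-+n∣≡∣m-n∣ m n = trans (cong ∣_∣ (ℤ.m-n≡m⊖n m n)) (∣⊖∣ m n)
  where
  ∣⊖∣ : ∀ m n → ∣ m ℤ.⊖ n ∣ ≡ ∣ m - n ∣
  ∣⊖∣ zero    zero    = refl
  ∣⊖∣ zero    (suc n) = refl
  ∣⊖∣ (suc m) zero    = refl
  ∣⊖∣ (suc m) (suc n) = trans (cong ∣_∣ (ℤ.[1+m]⊖[1+n]≡m⊖n m n)) (∣⊖∣ m n)

module Ornament {c f : ℕ} (f≤c : f ≤ c) (c≤1+f : c ≤ suc f) (5≤L : 5 ≤ c + f) where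
  open Labelling f≤c c≤1+f 5≤L

  private
    L = c + f

    3≤L : 3 ≤ L
    3≤L = ≤-trans (m≤m+n 3 2) 5≤L

  H : OrientedGraph (Fin 4 × Fin L)
  H = directedCycles 3≤L

  private
    module H = OrientedGraph H

  l : Fin L → ℕ
  l i = suc (height (toℕ i))

  h : Fin 4 × Fin L → ℕ
  h (a , i) = l i + toℕ a * L

  l-bijection : BijectionOnto L l
  l-bijection = bijectionOnto (finite-Fin L) (λ _ → z<s) (λ i → height-< (Fin.toℕ<n i))
    (λ {i} {j} eq → Fin.toℕ-injective (height-injective (Fin.toℕ<n i) (Fin.toℕ<n j) (suc-injective eq)))

  -- A label less one has quotient `a` and remainder `height` on division by `L`, which is how
  -- `Fin.combine` encodes a pair.
  h-bijection : BijectionOnto (4 * L) h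
  h-bijection = bijectionOnto H.finite (λ _ → z<s)
    (λ u → subst (_≤ 4 * L) (sym (h≡position u)) (Fin.toℕ<n (position u)))
    (λ {u} {v} eq → position-injective
      (Fin.toℕ-injective (suc-injective (trans (sym (h≡position u)) (trans eq (h≡position v))))))
    where
    heightF : Fin L → Fin L
    heightF i = fromℕ< (height-< (Fin.toℕ<n i))
    position : Fin 4 × Fin L → Fin (4 * L)
    position (a , i) = Fin.combine a (heightF i)
    h≡position : ∀ u → h u ≡ suc (toℕ (position u))
    h≡position (a , i) = cong suc (begin
      height (toℕ i) + toℕ a * L   ≡⟨ +-comm (height (toℕ i)) (toℕ a * L) ⟩
      toℕ a * L + height (toℕ i)   ≡⟨ cong₂ _+_ (*-comm (toℕ a) L) (sym (Fin.toℕ-fromℕ< (height-< (Fin.toℕ<n i)))) ⟩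
      L * toℕ a + toℕ (heightF i)  ≡⟨ Fin.toℕ-combine a (heightF i) ⟨
      toℕ (position (a , i))       ∎)
      where open ≡-Reasoning
    position-injective : Injective _≡_ _≡_ position
    position-injective {a , i} {b , j} eq with refl , heights ← Fin.combine-injective a (heightF i) b (heightF j) eq =
      cong (a ,_) (Fin.toℕ-injective (height-injective (Fin.toℕ<n i) (Fin.toℕ<n j)
        (Fin.fromℕ<-injective _ _ (height-< (Fin.toℕ<n i)) (height-< (Fin.toℕ<n j)) heights)))

  ∣wt∣≡gap : ∀ N a {p i q} → Next p i → Next i q →
    ∣ H.wt (λ u → N + h u) (a , i) ∣ ≡ gap (toℕ p) (toℕ q)
  ∣wt∣≡gap N a {p} {i} {q} pi iq = begin
    ∣ H.wt (λ u → N + h u) (a , i) ∣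
      ≡⟨ cong ∣_∣ (wt-directedCycles 3≤L _ l (λ a → N + toℕ a * L)
           (λ a i → exchange N (l i) (toℕ a * L)) a pi iq) ⟩
    ∣ directed (forward a) (+ l p ℤ.- + l q) ∣  ≡⟨ ∣directed∣ (forward a) _ ⟩
    ∣ + l p ℤ.- + l q ∣                         ≡⟨ ∣+m-+n∣≡∣m-n∣ (l p) (l q) ⟩
    gap (toℕ p) (toℕ q)                         ∎
    where
    open ≡-Reasoning
    exchange : ∀ x y z → x + (y + z) ≡ y + (x + z)
    exchange = solve-∀

  isOrnament : ∀ {s} → Exactly s (NodeLabel L) → IsOrnament s H h
  isOrnament exactly G g ddm 1≤N wt≤N = ddm⁺ , exactly⁺ , doubled
    where
    N = OrientedGraph.order G

    h⁺ : Fin 4 × Fin L → ℕ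
    h⁺ u = N + h u

    open WeightedSum G g ddm H h⁺
    module g = BijectionOnto (IsDDMLabeling.bijection ddm)

    gap≤N : ∀ {p i q} → Next p i → Next i q → gap (toℕ p) (toℕ q) ≤ N
    -- At shift 0 the labelling reduces to `h`, whose weights are bounded by hypothesis.
    gap≤N pi iq = subst (_≤ N) (∣wt∣≡gap 0 zero pi iq) (wt≤N _)

    injective⁺ : Injective _≡_ _≡_ [ g , h⁺ ]
    injective⁺ {inj₁ x} {inj₁ y} eq = cong inj₁ (g.injective eq)
    injective⁺ {inj₂ u} {inj₂ v} eq = cong inj₂ (BijectionOnto.injective h-bijection (+-cancelˡ-≡ N _ _ eq))
    injective⁺ {inj₁ x} {inj₂ v} eq = contradiction eq (<⇒≢ (≤-<-trans (g.bounded x) (m<m+n N z<s)))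
    injective⁺ {inj₂ u} {inj₁ y} eq = contradiction (sym eq) (<⇒≢ (≤-<-trans (g.bounded y) (m<m+n N z<s)))

    ddm⁺ : IsDDMLabeling S [ g , h⁺ ]
    ddm⁺ = record
      { bijection = bijectionOnto (OrientedGraph.finite S)
          (λ { (inj₁ x) → g.positive x ; (inj₂ u) → ≤-trans z<s (m≤n+m (h u) N) })
          (λ { (inj₁ x) → ≤-trans (g.bounded x) (m≤m+n N (4 * L))
             ; (inj₂ u) → +-monoʳ-≤ N (BijectionOnto.bounded h-bijection u) })
          injective⁺
      ; constant = 0ℤ , λ
          -- Here the shift `N` is absorbed into the base label, so that the copies stay exactly `L`
          -- apart.
          { (inj₁ x) → wt-left x (directedCycles-balanced 3≤L h⁺ (λ i → N + l i)
              (λ a i → sym (+-assoc N (l i) (toℕ a * L))) (g x))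
          ; (inj₂ (a , i)) → wt-right (a , i) (subst (_≤ N)
              (sym (∣wt∣≡gap N a (proj₂ (prev i)) (proj₂ (next i)))) (gap≤N (proj₂ (prev i)) (proj₂ (next i)))) }
      }

    node⇔nodeLabel : ∀ x → IsNode S x ⇔ NodeLabel L (g x)
    node⇔nodeLabel x = mk⇔
      (λ { ((a , i) , adj) → let _ , pi = prev i ; _ , iq = next i in
        subst (NodeLabel L) (trans (sym (∣wt∣≡gap N a pi iq)) (adjacent⇒label adj)) (gap-sound pi iq) })
      (λ label → let _ , i , _ , pi , iq , gap≡gx = gap-complete label in
        (zero , i) , label⇒adjacent (trans (∣wt∣≡gap N zero pi iq) gap≡gx))

    exactly⁺ : Exactly _ (IsNode S)
    exactly⁺ = Exactly-label (IsDDMLabeling.bijection ddm)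
      -- A node label is at most `N` because it is the modulus of some weight.
      (λ label → let _ , _ , _ , pi , iq , gap≡k = gap-complete label in
        proj₁ label , subst (_≤ N) gap≡k (gap≤N pi iq))
      node⇔nodeLabel exactly

    doubled : ∀ x → IsNode S x → ∃[ u ] ∃[ w ] u ≢ w ×
      OrientedGraph.Adjacent S (inj₁ x) (inj₂ u) × OrientedGraph.Adjacent S (inj₁ x) (inj₂ w)
    -- Adjacency depends only on the modulus of the weight, which all four copies of `i` share; any
    -- two of them would do.
    doubled x ((a , i) , adj) = (zero , i) , (suc zero , i) , (λ ()) , toCopy zero , toCopy (suc zero)
      where
      toCopy : ∀ b → OrientedGraph.Adjacent S (inj₁ x) (inj₂ (b , i))
      toCopy b = let _ , pi = prev i ; _ , iq = next i in
        label⇒adjacent (trans (∣wt∣≡gap N b pi iq) (trans (sym (∣wt∣≡gap N a pi iq)) (adjacent⇒label adj)))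

theorem2p3 : ∀ (L : ℕ) (5≤L : 5 ≤ L) →
    Σ[ H ∈ OrientedGraph (Fin 4 × Fin L) ]
    IsDirectedCycleOrientationOf (copies 4 (cycle L (≤-trans (m≤m+n 3 2) 5≤L))) H ×
    (Σ[ h ∈ (Fin 4 × Fin L → ℕ) ]
    BijectionOnto (4 * L) h ×
    RepetitiveConsecutive h ×
    IsOrnament (if does (2 ∣? L) then L ∸ 2 else L ∸ 1) H h)
theorem2p3 L 5≤L
  -- Since `⌈ L /2⌉` is `⌊ suc L /2⌋`, monotonicity bounds it by `⌊ suc (suc L) /2⌋`, which is
  -- `suc ⌊ L /2⌋`.
  with ⌈ L /2⌉ | ⌊ L /2⌋ | ⌊n/2⌋≤⌈n/2⌉ L | ⌊n/2⌋-mono (n≤1+n (suc L)) | ⌊n/2⌋+⌈n/2⌉≡n L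
... | c | f | f≤c | c≤1+f | f+c≡L with refl ← trans (+-comm c f) f+c≡L =
  H , directedCycles-orientation 3≤L 3≤L , h , h-bijection , (l , l-bijection , λ _ _ → refl) ,
  isOrnament (Exactly-nodeLabel (≤-trans (m≤m+n 2 3) 5≤L))
  where
  open Ornament f≤c c≤1+f 5≤L
  3≤L = ≤-trans (m≤m+n 3 2) 5≤L
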